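{- The two variants of the engine defined in the context are bisimilar: $\mathit{Eng} \approx \overline{\mathit{Eng}}$.
   Context: **Names and values.** There are sets of state variables $\mathcal{X}$, channels $\mathcal{C}$, actuators $\mathcal{A}$ and sensors $\mathcal{S}$. Values $v$ are built from basic values (Booleans, integers, real numbers) and also include names. For a set of names $\mathcal{N}$, $\mathbb{R}^{\mathcal{N}}$ is the set of functions $\mathcal{N}\to\mathbb{R}$, ordered pointwise; $\xi[n\mapsto v]$ is $\xi$ updated at $n$ to $v$. **Physical environment.** Given $\hat{\mathcal{X}}\subseteq\mathcal{X}$, $\hat{\mathcal{A}}\subseteq\mathcal{A}$, $\hat{\mathcal{S}}\subseteq\mathcal{S}$, a physical environment is a 7-tuple $E=\langle \xi_x,\xi_u,\xi_w,\mathit{evol},\xi_e,\mathit{meas},\mathit{inv}\rangle$ of total functions: state function $\xi_x\in\mathbb{R}^{\hat{\mathcal{X}}}$, actuator function $\xi_u\in\mathbb{R}^{\hat{\mathcal{A}}}$, uncertainty function $\xi_w\in\mathbb{R}^{\hat{\mathcal{X}}}$, evolution map $\mathit{evol}:\mathbb{R}^{\hat{\mathcal{X}}}\times\mathbb{R}^{\hat{\mathcal{A}}}\times\mathbb{R}^{\hat{\mathcal{X}}}\to 2^{\mathbb{R}^{\hat{\mathcal{X}}}}$, sensor-error function $\xi_e\in\mathbb{R}^{\hat{\mathcal{S}}}$, measurement map $\mathit{meas}:\mathbb{R}^{\hat{\mathcal{X}}}\times\mathbb{R}^{\hat{\mathcal{S}}}\to 2^{\mathbb{R}^{\hat{\mathcal{S}}}}$,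 invariant function $\mathit{inv}:\mathbb{R}^{\hat{\mathcal{X}}}\to\{\mathsf{true},\mathsf{false}\}$. Operators: $\mathit{read\_sensor}(E,s)=\{\xi(s):\xi\in\mathit{meas}(\xi_x,\xi_e)\}$; $\mathit{update\_act}(E,a,v)$ is $E$ with $\xi_u$ replaced by $\xi_u[a\mapsto v]$; $\mathit{next}(E)$ is the set of environments obtained from $E$ by replacing $\xi_x$ with some $\xi\in\mathit{evol}(\xi_x,\xi_u,\xi_w)$; $\mathit{inv}(E)=\mathit{inv}(\xi_x)$. **Processes.** $P,Q ::= \mathsf{nil} \mid \mathsf{tick}.P \mid P\parallel Q \mid \lfloor\pi.P\rfloor Q \mid \mathsf{if}\,(b)\,\{P\}\,\mathsf{else}\,\{Q\} \mid P\setminus c \mid X \mid \mathsf{fix}\,X.P$, with prefixes $\pi$ among: $\overline{c}\langle v\rangle$ (send $v$ on channel $c$), $c(x)$ (receive on $c$), $\mathsf{read}\,s(x)$ (read sensor $s$), $\mathsf{write}\,a\langle v\rangle$ (write $v$ on actuator $a$). The variable $x$ is bound in $\lfloor c(x).P\rfloor Q$ and $\lfloor\mathsf{read}\,s(x).P\rfloor Q$ (with scope $P$), and $X$ is bound in $\mathsf{fix}\,X.P$; processes are taken up to $\alpha$-conversion and are closed (no free variables or process variables). In $\mathsf{tick}.Q$ and $\lfloor\pi.P\rfloor Q$ the occurrence of $Q$ is time-guarded; in $\mathsf{fix}\,X.P$ all occurrences of $X$ in $P$ must be time-guarded. Guards $b$ are decidable, and $\mathsf{if}\,(b)\,\{P\}\,\mathsf{else}\,\{Q\}$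 is identified with $P$ if $b$ is true and with $Q$ if $b$ is false. $T\{v/x\}$ and $T\{P/X\}$ denote substitution. Abbreviations: $\pi.P$ stands for $\mathsf{fix}\,X.\lfloor\pi.P\rfloor X$ with $X$ not in $P$; $\mathsf{tick}^k.P$ is $k$ consecutive $\mathsf{tick}$ prefixes followed by $P$. **Process transitions** $P\xrightarrow{\lambda}P'$, $\lambda\in\{\mathsf{tick},\tau,\overline{c}v,cv,a!v,s?v\}$, are the least relation such that: $\lfloor\overline{c}\langle v\rangle.P\rfloor Q\xrightarrow{\overline{c}v}P$; $\lfloor c(x).P\rfloor Q\xrightarrow{cv}P\{v/x\}$; $\lfloor\mathsf{write}\,a\langle v\rangle.P\rfloor Q\xrightarrow{a!v}P$; $\lfloor\mathsf{read}\,s(x).P\rfloor Q\xrightarrow{s?v}P\{v/x\}$; if $P\xrightarrow{\overline{c}v}P'$ and $Q\xrightarrow{cv}Q'$ then $P\parallel Q\xrightarrow{\tau}P'\parallel Q'$ (and symmetrically); if $P\xrightarrow{\lambda}P'$ and $\lambda\ne\mathsf{tick}$ then $P\parallel Q\xrightarrow{\lambda}P'\parallel Q$ (and symmetrically); if $P\xrightarrow{\lambda}P'$ and $\lambda\notin\{cv,\overline{c}v\}$ then $P\setminus c\xrightarrow{\lambda}P'\setminus c$; if $P\{\mathsf{fix}\,X.P/X\}\xrightarrow{\lambda}Q$ then $\mathsf{fix}\,X.P\xrightarrow{\lambda}Q$; $\mathsf{nil}\xrightarrow{\mathsf{tick}}\mathsf{nil}$; $\mathsf{tick}.P\xrightarrow{\mathsf{tick}}P$;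 $\lfloor\pi.P\rfloor Q\xrightarrow{\mathsf{tick}}Q$; if $P\xrightarrow{\mathsf{tick}}P'$, $Q\xrightarrow{\mathsf{tick}}Q'$ and $P\parallel Q$ has no $\tau$-transition then $P\parallel Q\xrightarrow{\mathsf{tick}}P'\parallel Q'$. **CPSs.** A CPS is $M=E\Join P$, always assumed well-formed: every sensor $s$ mentioned in $P$ is in the domain of $\xi_e$ and every actuator $a$ mentioned in $P$ is in the domain of $\xi_u$. Transitions $M\xrightarrow{\alpha}M'$, $\alpha\in\{\tau,\overline{c}v,cv,\mathsf{tick}\}$, all requiring $\mathit{inv}(E)=\mathsf{true}$: - $E\Join P\xrightarrow{\overline{c}v}E\Join P'$ if $P\xrightarrow{\overline{c}v}P'$; $E\Join P\xrightarrow{cv}E\Join P'$ if $P\xrightarrow{cv}P'$; - (SensRead) $E\Join P\xrightarrow{\tau}E\Join P'$ if $P\xrightarrow{s?v}P'$ and $v\in\mathit{read\_sensor}(E,s)$; - (ActWrite) $E\Join P\xrightarrow{\tau}\mathit{update\_act}(E,a,v)\Join P'$ if $P\xrightarrow{a!v}P'$; - (Tau) $E\Join P\xrightarrow{\tau}E\Join P'$ if $P\xrightarrow{\tau}P'$; - (Time) $E\Join P\xrightarrow{\mathsf{tick}}E'\Join P'$ if $P\xrightarrow{\mathsf{tick}}P'$, $E\Join P$ has no $\tau$-transition, and $E'\in\mathit{next}(E)$. **Bisimilarity.** $\Rightarrow$ is the reflexive-transitive closure of $\xrightarrow{\tau}$; $\stackrel{\alpha}{\Rightarrow}$ is $\Rightarrow\xrightarrow{\alpha}\Rightarrow$;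 $\stackrel{\hat\alpha}{\Rightarrow}$ is $\Rightarrow$ if $\alpha=\tau$ and $\stackrel{\alpha}{\Rightarrow}$ otherwise. A symmetric relation $\mathcal{R}$ on CPSs is a bisimulation if $M\,\mathcal{R}\,N$ and $M\xrightarrow{\alpha}M'$ imply that there is $N'$ with $N\stackrel{\hat\alpha}{\Rightarrow}N'$ and $M'\,\mathcal{R}\,N'$. $M\approx N$ iff $M\,\mathcal{R}\,N$ for some bisimulation $\mathcal{R}$. **The engine.** $\mathit{Env}=\langle \xi_x,\xi_u,\xi_w,\mathit{evol},\xi_e,\mathit{meas},\mathit{inv}\rangle$ has one state variable $\mathit{temp}$, one actuator $\mathit{cool}$, one sensor $s_t$, and: $\xi_x(\mathit{temp})=0$; $\xi_u(\mathit{cool})=\mathsf{off}$ (actuator values are regarded as elements of $\{\mathsf{on},\mathsf{off}\}$, a real value $\ge0$ standing for $\mathsf{off}$ and $<0$ for $\mathsf{on}$); $\xi_w(\mathit{temp})=\delta=0.4$; $\mathit{evol}(\xi_x^i,\xi_u^i,\xi_w)=\{\xi:\xi(\mathit{temp})=\xi_x^i(\mathit{temp})+\mathit{heat}(\xi_u^i,\mathit{cool})+\gamma,\ \gamma\in[-\delta,+\delta]\}$, where $\mathit{heat}(\xi_u^i,\mathit{cool})=-1$ if $\xi_u^i(\mathit{cool})=\mathsf{on}$ and $+1$ if $\xi_u^i(\mathit{cool})=\mathsf{off}$; $\xi_e(s_t)=\epsilon=0.1$; $\mathit{meas}(\xi_x^i,\xi_e)=\{\xi:\xi(s_t)\in[\xi_x^i(\mathit{temp})-\epsilon,\xi_x^i(\mathit{temp})+\epsilon]\}$;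 $\mathit{inv}(\xi_x)=\mathsf{true}$ iff $0\le\xi_x(\mathit{temp})\le30$. The controller is $$\mathit{Ctrl}=\mathsf{fix}\,X.\,\mathsf{read}\,s_t(x).\,\mathsf{if}\,(x>10)\,\{\mathit{Cooling}\}\,\mathsf{else}\,\{\mathsf{tick}.X\},$$ $$\mathit{Cooling}=\mathsf{write}\,\mathit{cool}\langle\mathsf{on}\rangle.\,\mathsf{fix}\,Y.\,\mathsf{tick}^5.\,\mathsf{read}\,s_t(x).\,\mathsf{if}\,(x>10)\,\{\overline{\mathit{warning}}\langle\mathrm{ID}\rangle.Y\}\,\mathsf{else}\,\{\mathsf{write}\,\mathit{cool}\langle\mathsf{off}\rangle.\mathsf{tick}.X\},$$ where $\mathit{warning}$ is a channel and $\mathrm{ID}$ a value (the engine identifier). $\mathit{Eng}=\mathit{Env}\Join\mathit{Ctrl}$. **The variant.** $\overline{\mathit{Eng}}=\overline{\mathit{Env}}\Join\mathit{Ctrl}$, where $\overline{\mathit{Env}}$ is the same as $\mathit{Env}$ except that in the evolution map $\mathit{heat}(\xi_u^i,\mathit{cool})=-0.8$ if $\xi_u^i(\mathit{cool})=\mathsf{on}$. -}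

module Defs where

open import Algebra.Structures using (IsCommutativeRing)
open import Data.Bool using (Bool; true; false; if_then_else_; _∧_)
open import Data.Fin using (Fin; zero; suc; _↑ʳ_)
open import Data.Integer as ℤ using (ℤ)
open import Data.Irrelevant using ([_])
open import Data.Nat using (ℕ; zero; suc; _+_)
open import Data.Product using (∃; ∃-syntax; _×_; _,_)
open import Data.Refinement using (Refinement; Refinement-syntax; value; _,_)
open import Data.Unit using (⊤; tt)
open import Data.Vec.Functional using (Vector; []; _∷_)
open import Function using (_∘_)
open import Level using (0ℓ) renaming (suc to lsuc)
open import Relation.Binary.Construct.Closure.ReflexiveTransitive using (Star)
open import Relation.Binary.Core using (Rel)
open import Relation.Binary.Definitions using (DecidableEquality; Decidable; Symmetric)
open import Relation.Binary.PropositionalEquality using (_≡_; _≢_; refl)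
open import Relation.Binary.Structures using (IsDecTotalOrder)
import Relation.Binary.Construct.NonStrictToStrict as Strict
open import Relation.Nullary using (¬_; does)
open import Relation.Unary using (Pred; _∈_; ｛_｝)

-- The real numbers, axiomatised classically: a Dedekind-complete ordered
-- field with decidable order.  The inverse is total, with an unspecified value
-- at 0#.

record Reals : Set₁ where
  infix  8 -_
  infixl 7 _*_
  infixl 6 _⊕_
  infix  4 _≤_ _<_ _<?_
  field
    ℝ       : Set
    _⊕_ _*_ : ℝ → ℝ → ℝ
    -_ _⁻¹  : ℝ → ℝ
    0# 1#   : ℝ
    _≤_     : Rel ℝ 0ℓ
    isCommutativeRing : IsCommutativeRing _≡_ _⊕_ _*_ -_ 0# 1#
    isDecTotalOrder   : IsDecTotalOrder _≡_ _≤_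
    0≢1          : 0# ≢ 1#
    *-inverseʳ   : ∀ x → x ≢ 0# → x * x ⁻¹ ≡ 1#
    ⊕-monoˡ-≤    : ∀ z {x y} → x ≤ y → x ⊕ z ≤ y ⊕ z
    *-nonNeg     : ∀ {x y} → 0# ≤ x → 0# ≤ y → 0# ≤ x * y

  UpperBound : Pred ℝ 0ℓ → Pred ℝ 0ℓ
  UpperBound S u = ∀ x → x ∈ S → x ≤ u

  field
    supremum : (S : Pred ℝ 0ℓ) → ∃ S → ∃ (UpperBound S) →
               ∃[ s ] (s ∈ UpperBound S × (∀ u → u ∈ UpperBound S → s ≤ u))

  open IsDecTotalOrder isDecTotalOrder public using (_≟_; _≤?_)

  _<_ : Rel ℝ 0ℓ
  _<_ = Strict._<_ _≡_ _≤_

  _<?_ : Decidable _<_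
  _<?_ = Strict.<-decidable _≡_ _≤_ _≟_ _≤?_

  fromℕ : ℕ → ℝ
  fromℕ zero    = 0#
  fromℕ (suc n) = 1# ⊕ fromℕ n

  tenths : ℕ → ℝ
  tenths n = fromℕ n * fromℕ 10 ⁻¹

record Names : Set₁ where
  field
    𝒳 𝒞 𝒜 𝒮 : Set
    _≟ᴬ_    : DecidableEquality 𝒜

module Calculus (𝓡 : Reals) (𝓝 : Names) where
  open Reals 𝓡
  open Names 𝓝

  data Value : Set where
    bool : Bool → Value
    int  : ℤ → Value
    real : ℝ → Value
    var  : 𝒳 → Value
    chan : 𝒞 → Value
    act  : 𝒜 → Value
    sens : 𝒮 → Value

  -- A subset is a predicate; its elements carry an irrelevant membership
  -- proof, so that they are determined by the underlying name.

  Elem : {N : Set} → Pred N 0ℓ → Set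
  Elem {N} N̂ = [ n ∈ N ∣ N̂ n ]

  ℝ^_ : {N : Set} → Pred N 0ℓ → Set
  ℝ^ N̂ = Elem N̂ → ℝ

  record PhysEnv : Set₁ where
    field
      X̂    : Pred 𝒳 0ℓ
      Â    : Pred 𝒜 0ℓ
      Ŝ    : Pred 𝒮 0ℓ
      ξx   : ℝ^ X̂
      ξu   : ℝ^ Â
      ξw   : ℝ^ X̂
      evol : ℝ^ X̂ → ℝ^ Â → ℝ^ X̂ → Pred (ℝ^ X̂) 0ℓ
      ξe   : ℝ^ Ŝ
      meas : ℝ^ X̂ → ℝ^ Ŝ → Pred (ℝ^ Ŝ) 0ℓ
      inv  : ℝ^ X̂ → Bool

  readSensor : (E : PhysEnv) → Elem (PhysEnv.Ŝ E) → Pred ℝ 0ℓ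
  readSensor E s r = ∃[ ξ ] (ξ ∈ meas ξx ξe × r ≡ ξ s)
    where open PhysEnv E

  updateAct : (E : PhysEnv) → Elem (PhysEnv.Â E) → ℝ → PhysEnv
  updateAct E a r = record E
    { ξu = λ a′ → if does (value a′ ≟ᴬ value a) then r else PhysEnv.ξu E a′ }

  next : PhysEnv → Pred PhysEnv (lsuc 0ℓ)
  next E E′ = ∃[ ξ ] (ξ ∈ evol ξx ξu ξw × E′ ≡ record E { ξx = ξ })
    where open PhysEnv E

  Inv : PhysEnv → Bool
  Inv E = PhysEnv.inv E (PhysEnv.ξx E)

  -- Process syntax with de Bruijn indices, so that α-equivalent processes are
  -- equal: m counts the value variables in scope, n the process variables.

  data Term (m : ℕ) : Set where
    ‵_  : Fin m → Term m
    val : Value → Term m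

  Guard : ℕ → Set
  Guard m = Vector Value m → Bool

  -- The second index is the number of value variables bound by the prefix.

  data Prefix (m : ℕ) : ℕ → Set where
    send  : 𝒞 → Term m → Prefix m 0
    recv  : 𝒞 → Prefix m 1
    read  : 𝒮 → Prefix m 1
    write : 𝒜 → Term m → Prefix m 0

  infixr 6 _∥_
  infixl 8 _∖_

  data Proc (m n : ℕ) : Set where
    nil    : Proc m n
    tick   : Proc m n → Proc m n
    _∥_    : Proc m n → Proc m n → Proc m n
    ⌊_∙_⌋_ : ∀ {b} → Prefix m b → Proc (b + m) n → Proc m n → Proc m n
    ite    : Guard m → Proc m n → Proc m n → Proc m n
    _∖_    : Proc m n → 𝒞 → Proc m n
    pvar   : Fin n → Proc m n
    fix    : Proc m (suc n) → Proc m n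

  Process : Set
  Process = Proc 0 0

  private variable
    m m′ n n′ b : ℕ

  eval : Vector Value m → Term m → Value
  eval ρ (‵ i)   = ρ i
  eval ρ (val v) = v

  weaken : ∀ b → Vector (Term (b + m)) m
  weaken b i = ‵ (b ↑ʳ i)

  substTerm : Vector (Term m′) m → Term m → Term m′
  substTerm σ (‵ i)   = σ i
  substTerm σ (val v) = val v

  lift : ∀ b → Vector (Term m′) m → Vector (Term (b + m′)) (b + m)
  lift zero    σ = σ
  lift (suc b) σ = (‵ zero) ∷ (substTerm (weaken 1) ∘ lift b σ)

  substPrefix : Vector (Term m′) m → Prefix m b → Prefix m′ b
  substPrefix σ (send c t)  = send c (substTerm σ t)
  substPrefix σ (recv c)    = recv c
  substPrefix σ (read s)    = read s
  substPrefix σ (write a t) = write a (substTerm σ t)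

  substVal : Vector (Term m′) m → Proc m n → Proc m′ n
  substVal σ nil                   = nil
  substVal σ (tick P)              = tick (substVal σ P)
  substVal σ (P ∥ Q)               = substVal σ P ∥ substVal σ Q
  substVal σ (⌊_∙_⌋_ {b} π P Q)    =
    ⌊ substPrefix σ π ∙ substVal (lift b σ) P ⌋ substVal σ Q
  substVal σ (ite g P Q)           =
    ite (λ ρ → g (eval ρ ∘ σ)) (substVal σ P) (substVal σ Q)
  substVal σ (P ∖ c)               = substVal σ P ∖ c
  substVal σ (pvar X)              = pvar X
  substVal σ (fix P)               = fix (substVal σ P)

  liftRen : (Fin n → Fin n′) → Fin (suc n) → Fin (suc n′)
  liftRen ρ zero    = zero
  liftRen ρ (suc X) = suc (ρ X)

  renProc : (Fin n → Fin n′) → Proc m n → Proc m n′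
  renProc ρ nil             = nil
  renProc ρ (tick P)        = tick (renProc ρ P)
  renProc ρ (P ∥ Q)         = renProc ρ P ∥ renProc ρ Q
  renProc ρ (⌊ π ∙ P ⌋ Q)   = ⌊ π ∙ renProc ρ P ⌋ renProc ρ Q
  renProc ρ (ite g P Q)     = ite g (renProc ρ P) (renProc ρ Q)
  renProc ρ (P ∖ c)         = renProc ρ P ∖ c
  renProc ρ (pvar X)        = pvar (ρ X)
  renProc ρ (fix P)         = fix (renProc (liftRen ρ) P)

  substProc : Vector (Proc m n′) n → Proc m n → Proc m n′
  substProc σ nil                = nil
  substProc σ (tick P)           = tick (substProc σ P)
  substProc σ (P ∥ Q)            = substProc σ P ∥ substProc σ Q
  substProc σ (⌊_∙_⌋_ {b} π P Q) =
    ⌊ π ∙ substProc (substVal (weaken b) ∘ σ) P ⌋ substProc σ Q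
  substProc σ (ite g P Q)        = ite g (substProc σ P) (substProc σ Q)
  substProc σ (P ∖ c)            = substProc σ P ∖ c
  substProc σ (pvar X)           = σ X
  substProc σ (fix P)            =
    fix (substProc (pvar zero ∷ (renProc suc ∘ σ)) P)

  infix 9 _[_/x] _[_/X]

  _[_/x] : Proc (suc m) n → Value → Proc m n
  P [ v /x] = substVal (val v ∷ ‵_) P

  _[_/X] : Proc m (suc n) → Proc m n → Proc m n
  P [ Q /X] = substProc (Q ∷ pvar) P

  infixr 7 _⨾_

  _⨾_ : Prefix m b → Proc (b + m) n → Proc m n
  π ⨾ P = fix (⌊ π ∙ renProc suc P ⌋ pvar zero)

  tick^ : ℕ → Proc m n → Proc m n
  tick^ zero    P = P
  tick^ (suc k) P = tick (tick^ k P)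

  _GuardedIn_ : Fin n → Proc m n → Set
  X GuardedIn nil           = ⊤
  X GuardedIn tick P        = ⊤
  X GuardedIn (P ∥ Q)       = X GuardedIn P × X GuardedIn Q
  X GuardedIn (⌊ π ∙ P ⌋ Q) = X GuardedIn P
  X GuardedIn ite g P Q     = X GuardedIn P × X GuardedIn Q
  X GuardedIn (P ∖ c)       = X GuardedIn P
  X GuardedIn pvar Y        = X ≢ Y
  X GuardedIn fix P         = suc X GuardedIn P

  TimeGuarded : Proc m n → Set
  TimeGuarded nil           = ⊤
  TimeGuarded (tick P)      = TimeGuarded P
  TimeGuarded (P ∥ Q)       = TimeGuarded P × TimeGuarded Q
  TimeGuarded (⌊ π ∙ P ⌋ Q) = TimeGuarded P × TimeGuarded Q
  TimeGuarded (ite g P Q)   = TimeGuarded P × TimeGuarded Q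
  TimeGuarded (P ∖ c)       = TimeGuarded P
  TimeGuarded (pvar X)      = ⊤
  TimeGuarded (fix P)       = zero GuardedIn P × TimeGuarded P

  PrefixOver : Pred 𝒜 0ℓ → Pred 𝒮 0ℓ → Prefix m b → Set
  PrefixOver Â Ŝ (send c t)  = ⊤
  PrefixOver Â Ŝ (recv c)    = ⊤
  PrefixOver Â Ŝ (read s)    = s ∈ Ŝ
  PrefixOver Â Ŝ (write a t) = a ∈ Â

  ProcOver : Pred 𝒜 0ℓ → Pred 𝒮 0ℓ → Proc m n → Set
  ProcOver Â Ŝ nil           = ⊤
  ProcOver Â Ŝ (tick P)      = ProcOver Â Ŝ P
  ProcOver Â Ŝ (P ∥ Q)       = ProcOver Â Ŝ P × ProcOver Â Ŝ Q
  ProcOver Â Ŝ (⌊ π ∙ P ⌋ Q) =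
    PrefixOver Â Ŝ π × ProcOver Â Ŝ P × ProcOver Â Ŝ Q
  ProcOver Â Ŝ (ite g P Q)   = ProcOver Â Ŝ P × ProcOver Â Ŝ Q
  ProcOver Â Ŝ (P ∖ c)       = ProcOver Â Ŝ P
  ProcOver Â Ŝ (pvar X)      = ⊤
  ProcOver Â Ŝ (fix P)       = ProcOver Â Ŝ P

  data Action : Set where
    τ       : Action
    out inp : 𝒞 → Value → Action
    wr      : 𝒜 → Value → Action
    rd      : 𝒮 → Value → Action

  _avoids_ : Action → 𝒞 → Set
  out d v avoids c = d ≢ c
  inp d v avoids c = d ≢ c
  τ       avoids c = ⊤
  wr a v  avoids c = ⊤
  rd s v  avoids c = ⊤

  -- The non-tick transitions do not depend on the tick transitions; defining
  -- them first makes sense of the negative premise in the tick rule for _∥_.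
  -- In both relations a closed conditional has exactly the transitions of the
  -- branch selected by its guard, with which it is to be identified.

  infix 3 _–[_]→_ _–tick→_

  data _–[_]→_ : Process → Action → Process → Set where
    sendᵖ  : ∀ {c v P Q} → ⌊ send c (val v) ∙ P ⌋ Q –[ out c v ]→ P
    recvᵖ  : ∀ {c v P Q} → ⌊ recv c ∙ P ⌋ Q –[ inp c v ]→ P [ v /x]
    writeᵖ : ∀ {a v P Q} → ⌊ write a (val v) ∙ P ⌋ Q –[ wr a v ]→ P
    readᵖ  : ∀ {s v P Q} → ⌊ read s ∙ P ⌋ Q –[ rd s v ]→ P [ v /x]
    commˡ  : ∀ {c v P P′ Q Q′} → P –[ out c v ]→ P′ → Q –[ inp c v ]→ Q′ →
             P ∥ Q –[ τ ]→ P′ ∥ Q′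
    commʳ  : ∀ {c v P P′ Q Q′} → P –[ inp c v ]→ P′ → Q –[ out c v ]→ Q′ →
             P ∥ Q –[ τ ]→ P′ ∥ Q′
    parˡ   : ∀ {l P P′ Q} → P –[ l ]→ P′ → P ∥ Q –[ l ]→ P′ ∥ Q
    parʳ   : ∀ {l P Q Q′} → Q –[ l ]→ Q′ → P ∥ Q –[ l ]→ P ∥ Q′
    resᵖ   : ∀ {l c P P′} → P –[ l ]→ P′ → l avoids c → P ∖ c –[ l ]→ P′ ∖ c
    fixᵖ   : ∀ {l P Q} → P [ fix P /X] –[ l ]→ Q → fix P –[ l ]→ Q
    iteᵖ   : ∀ {l g P Q R} → (if g [] then P else Q) –[ l ]→ R →
             ite g P Q –[ l ]→ R

  data _–tick→_ : Process → Process → Set where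
    nilᵗ     : nil –tick→ nil
    tickᵗ    : ∀ {P} → tick P –tick→ P
    timeoutᵗ : ∀ {b} {π : Prefix 0 b} {P Q} → ⌊ π ∙ P ⌋ Q –tick→ Q
    parᵗ     : ∀ {P P′ Q Q′} → P –tick→ P′ → Q –tick→ Q′ →
               ¬ (∃[ R ] P ∥ Q –[ τ ]→ R) → P ∥ Q –tick→ P′ ∥ Q′
    resᵗ     : ∀ {c P P′} → P –tick→ P′ → P ∖ c –tick→ P′ ∖ c
    fixᵗ     : ∀ {P Q} → P [ fix P /X] –tick→ Q → fix P –tick→ Q
    iteᵗ     : ∀ {g P Q R} → (if g [] then P else Q) –tick→ R →
               ite g P Q –tick→ R

  infix 4 _⋈_

  record System : Set₁ where
    constructor _⋈_
    field
      env  : PhysEnv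
      proc : Process

  WellFormed : System → Set
  WellFormed (E ⋈ P) = TimeGuarded P × ProcOver Â Ŝ P
    where open PhysEnv E

  CPS : Set₁
  CPS = [ M ∈ System ∣ WellFormed M ]

  data Label : Set where
    τ tick  : Label
    out inp : 𝒞 → Value → Label

  infix 3 _–τ→_ _⟶[_]_ _⇒_ _⇒[_]_ _⇒̂[_]_ _≈_

  data _–τ→_ : System → System → Set₁ where
    sensRead : ∀ {E P P′ r} (s : Elem (PhysEnv.Ŝ E)) → Inv E ≡ true →
               P –[ rd (value s) (real r) ]→ P′ → r ∈ readSensor E s →
               E ⋈ P –τ→ E ⋈ P′
    actWrite : ∀ {E P P′ r} (a : Elem (PhysEnv.Â E)) → Inv E ≡ true →
               P –[ wr (value a) (real r) ]→ P′ →
               E ⋈ P –τ→ updateAct E a r ⋈ P′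
    tau      : ∀ {E P P′} → Inv E ≡ true → P –[ τ ]→ P′ → E ⋈ P –τ→ E ⋈ P′

  data _⟶[_]_ : System → Label → System → Set₁ where
    out  : ∀ {E P P′ c v} → Inv E ≡ true → P –[ out c v ]→ P′ →
           E ⋈ P ⟶[ out c v ] E ⋈ P′
    inp  : ∀ {E P P′ c v} → Inv E ≡ true → P –[ inp c v ]→ P′ →
           E ⋈ P ⟶[ inp c v ] E ⋈ P′
    τ    : ∀ {M M′} → M –τ→ M′ → M ⟶[ τ ] M′
    time : ∀ {E E′ P P′} → Inv E ≡ true → P –tick→ P′ →
           ¬ (∃[ M ] E ⋈ P –τ→ M) → E′ ∈ next E →
           E ⋈ P ⟶[ tick ] E′ ⋈ P′

  _⇒_ : Rel System (lsuc 0ℓ)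
  _⇒_ = Star _–τ→_

  _⇒[_]_ : System → Label → System → Set₁
  M ⇒[ α ] N = ∃[ M′ ] ∃[ N′ ] (M ⇒ M′ × M′ ⟶[ α ] N′ × N′ ⇒ N)

  _⇒̂[_]_ : System → Label → System → Set₁
  M ⇒̂[ τ ] N       = M ⇒ N
  M ⇒̂[ tick ] N    = M ⇒[ tick ] N
  M ⇒̂[ out c v ] N = M ⇒[ out c v ] N
  M ⇒̂[ inp c v ] N = M ⇒[ inp c v ] N

  record IsBisimulation (R : Rel CPS (lsuc 0ℓ)) : Set₁ where
    field
      symmetric : Symmetric R
      transfer  : ∀ {M N M′ α} → R M N → value M ⟶[ α ] value M′ →
                  ∃[ N′ ] (value N ⇒̂[ α ] value N′ × R M′ N′)

  _≈_ : CPS → CPS → Set₂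
  M ≈ N = ∃[ R ] (IsBisimulation R × R M N)

  module Engine (temp : 𝒳) (cool : 𝒜) (sₜ : 𝒮) (warning : 𝒞) (ID : Value)
                (on off : ℝ) where

    tempᵉ : Elem ｛ temp ｝
    tempᵉ = temp , [ refl ]

    coolᵉ : Elem ｛ cool ｝
    coolᵉ = cool , [ refl ]

    sₜᵉ : Elem ｛ sₜ ｝
    sₜᵉ = sₜ , [ refl ]

    -- The first argument is the heat lost per time unit while cooling is on.

    heat : ℝ → ℝ^ ｛ cool ｝ → ℝ
    heat h ξu = if does (ξu coolᵉ <? 0#) then - h else 1#

    Envʰ : ℝ → PhysEnv
    Envʰ h = record
      { X̂    = ｛ temp ｝
      ; Â    = ｛ cool ｝
      ; Ŝ    = ｛ sₜ ｝
      ; ξx   = λ _ → 0#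
      ; ξu   = λ _ → off
      ; ξw   = λ _ → tenths 4
      ; evol = λ ξx ξu ξw ξ → ∃[ γ ]
          (- ξw tempᵉ ≤ γ × γ ≤ ξw tempᵉ × ξ tempᵉ ≡ ξx tempᵉ ⊕ heat h ξu ⊕ γ)
      ; ξe   = λ _ → tenths 1
      ; meas = λ ξx ξe ξ →
          ξx tempᵉ ⊕ - ξe sₜᵉ ≤ ξ sₜᵉ × ξ sₜᵉ ≤ ξx tempᵉ ⊕ ξe sₜᵉ
      ; inv  = λ ξx → does (0# ≤? ξx tempᵉ) ∧ does (ξx tempᵉ ≤? fromℕ 30)
      }

    -- The value of the conditions on values that are not numbers is immaterial:
    -- sensors only ever return reals.

    exceeds10 : Value → Bool
    exceeds10 (real r) = does (fromℕ 10 <? r)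
    exceeds10 (int i)  = does (ℤ.+ 10 ℤ.<? i)
    exceeds10 _        = false

    x>10 : ∀ {m} → Guard (suc m)
    x>10 ρ = exceeds10 (ρ zero)

    Cooling : Proc 1 1
    Cooling =
      write cool (val (real on)) ⨾ fix (tick^ 5 (read sₜ ⨾
        ite x>10 (send warning (val ID) ⨾ pvar zero)
                 (write cool (val (real off)) ⨾ tick (pvar (suc zero)))))

    Ctrl : Process
    Ctrl = fix (read sₜ ⨾ ite x>10 Cooling (tick (pvar zero)))

    Ctrl-timeGuarded : TimeGuarded Ctrl
    Ctrl-timeGuarded = (tt , tt) , ((tt , tt) , (coolingG , tt) , tt)
      where
      loopG    = ((λ ()) , tt) , (((λ ()) , tt , tt) , (tt , tt , tt)) , tt
      coolingG = tt , (tt , loopG) , tt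

    Ctrl-over : ProcOver ｛ cool ｝ ｛ sₜ ｝ Ctrl
    Ctrl-over = refl , (coolingO , tt) , tt
      where
      loopO    = refl , ((tt , tt , tt) , (refl , tt , tt)) , tt
      coolingO = refl , loopO , tt

    engine : ℝ → CPS
    engine h = (Envʰ h ⋈ Ctrl) , [ (Ctrl-timeGuarded , Ctrl-over) ]

    Eng : CPS
    Eng = engine 1#

    Engᵛ : CPS
    Engᵛ = engine (tenths 8)

-- In both variants the controller switches the cooling on at a temperature in
-- [9.9, 11.5], and five time units of cooling bring it down to [2.9, 9.5], so the
-- next sensor reading cannot exceed 10: no warning is ever sent and the invariant
-- never fails.  Hence from every reachable state only τ and tick are possible, and
-- a tick can be reached after at most two τ-steps.  The relation between any two
-- states satisfying these bounds is therefore a bisimulation: a τ-step is answered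
-- by staying put, and a tick by running to the next tick.

module Submission where

open import Algebra.Bundles using (CommutativeRing)
import Algebra.Properties.AbelianGroup as AbelianGroupProperties
import Algebra.Properties.CommutativeSemigroup as CommutativeSemigroupProperties
import Algebra.Properties.Ring as RingProperties
open import Data.Bool using (true; false; if_then_else_; _∧_)
open import Data.Empty using (⊥-elim)
open import Data.Irrelevant using ([_])
open import Data.Fin as Fin using (Fin; zero; suc)
open import Data.Nat as ℕ using (ℕ; zero; suc; _+_; z≤n)
import Data.Nat.Properties as ℕ
open import Data.Product using (∃-syntax; _×_; _,_; proj₁; proj₂)
open import Data.Refinement using (value; _,_)
open import Data.Sum using (inj₁; inj₂)
open import Data.Unit using (tt)
open import Data.Vec.Functional using ([])
open import Level using (0ℓ) renaming (suc to lsuc)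
open import Relation.Binary.Bundles using (Poset)
open import Relation.Binary.Core using (Rel)
open import Relation.Binary.Construct.Closure.ReflexiveTransitive using (ε; _◅_)
import Relation.Binary.Reasoning.PartialOrder as ≤-Reasoning
open import Relation.Binary.PropositionalEquality
  using (_≡_; _≢_; refl; sym; trans; cong; cong₂; subst; subst₂)
open import Relation.Binary.Structures using (IsDecTotalOrder)
open import Relation.Nullary using (¬_; Dec; does; yes; no; ¬?; _×-dec_)
open import Relation.Nullary.Decidable using (dec-true; dec-false; toWitness)
open import Relation.Unary using (Pred; ｛_｝)

open import Defs

-- Arithmetic of the ordered field and of multiples of one tenth.

module RealArithmetic (𝓡 : Reals) where
  open Reals 𝓡
  open IsDecTotalOrder isDecTotalOrder public
    using (isPartialOrder)
    renaming (refl to ≤-refl; reflexive to ≤-reflexive; trans to ≤-trans;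
              antisym to ≤-antisym; total to ≤-total)

  commutativeRing : CommutativeRing 0ℓ 0ℓ
  commutativeRing = record { isCommutativeRing = isCommutativeRing }

  poset : Poset 0ℓ 0ℓ 0ℓ
  poset = record { isPartialOrder = isPartialOrder }

  open CommutativeRing commutativeRing
    using (ring; +-abelianGroup; +-commutativeSemigroup; +-assoc; +-comm;
           +-identityˡ; +-identityʳ; -‿inverseˡ; -‿inverseʳ; distribʳ; *-identityʳ; zeroˡ)
  open RingProperties ring using (-‿distribʳ-*)
  open AbelianGroupProperties +-abelianGroup using (⁻¹-involutive)
  open CommutativeSemigroupProperties +-commutativeSemigroup using (xy∙z≈xz∙y)

  x⊕y⊕-y : ∀ x y → x ⊕ y ⊕ - y ≡ x
  x⊕y⊕-y x y = trans (+-assoc x y (- y))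
    (trans (cong (x ⊕_) (-‿inverseʳ y)) (+-identityʳ x))

  x⊕-y⊕y : ∀ x y → x ⊕ - y ⊕ y ≡ x
  x⊕-y⊕y x y = trans (+-assoc x (- y) y)
    (trans (cong (x ⊕_) (-‿inverseˡ y)) (+-identityʳ x))

  x⊕0 : ∀ x → x ⊕ 0# ≡ x
  x⊕0 = +-identityʳ

  x⊕-y⊕z : ∀ x y z → x ⊕ - y ⊕ z ≡ x ⊕ z ⊕ - y
  x⊕-y⊕z x y z = xy∙z≈xz∙y x (- y) z

  ⊕-monoʳ-≤ : ∀ z {x y} → x ≤ y → z ⊕ x ≤ z ⊕ y
  ⊕-monoʳ-≤ z {x} {y} x≤y = subst₂ _≤_ (+-comm x z) (+-comm y z) (⊕-monoˡ-≤ z x≤y)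

  ⊕-mono-≤ : ∀ {w x y z} → w ≤ x → y ≤ z → w ⊕ y ≤ x ⊕ z
  ⊕-mono-≤ {x = x} {y} w≤x y≤z = ≤-trans (⊕-monoˡ-≤ y w≤x) (⊕-monoʳ-≤ x y≤z)

  -‿anti-≤ : ∀ {x y} → x ≤ y → - y ≤ - x
  -‿anti-≤ {x} {y} x≤y = begin
    - y                ≡⟨ x⊕y⊕-y (- y) x ⟨
    - y ⊕ x ⊕ - x      ≤⟨ ⊕-monoˡ-≤ (- x) (⊕-monoʳ-≤ (- y) x≤y) ⟩
    - y ⊕ y ⊕ - x      ≡⟨ cong (_⊕ - x) (-‿inverseˡ y) ⟩
    0# ⊕ - x           ≡⟨ +-identityˡ (- x) ⟩
    - x                ∎
    where open ≤-Reasoning poset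

  -0≡0 : - 0# ≡ 0#
  -0≡0 = trans (sym (+-identityˡ (- 0#))) (-‿inverseʳ 0#)

  ≤0⇒0≤- : ∀ {x} → x ≤ 0# → 0# ≤ - x
  ≤0⇒0≤- x≤0 = subst (_≤ _) -0≡0 (-‿anti-≤ x≤0)

  0≤⇒-≤0 : ∀ {x} → 0# ≤ x → - x ≤ 0#
  0≤⇒-≤0 0≤x = subst (_ ≤_) -0≡0 (-‿anti-≤ 0≤x)

  0≤-⇒≤0 : ∀ {x} → 0# ≤ - x → x ≤ 0#
  0≤-⇒≤0 {x} 0≤-x = subst₂ _≤_ (⁻¹-involutive x) -0≡0 (-‿anti-≤ 0≤-x)

  -- If `1# ≤ 0#`, then `- 1#` is nonnegative, and so is its square, which is `1#`.
  0≤1 : 0# ≤ 1#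
  0≤1 with ≤-total 0# 1#
  ... | inj₁ 0≤1 = 0≤1
  ... | inj₂ 1≤0 = subst (0# ≤_) -1*-1≡1 (*-nonNeg (≤0⇒0≤- 1≤0) (≤0⇒0≤- 1≤0))
    where
    -1*-1≡1 : - 1# * - 1# ≡ 1#
    -1*-1≡1 = trans (sym (-‿distribʳ-* (- 1#) 1#))
      (trans (cong -_ (*-identityʳ (- 1#))) (⁻¹-involutive 1#))

  1≰0 : ¬ 1# ≤ 0#
  1≰0 1≤0 = 0≢1 (≤-antisym 0≤1 1≤0)

  ≤⇒≯ : ∀ {x y} → x ≤ y → ¬ y < x
  ≤⇒≯ x≤y (y≤x , y≢x) = y≢x (≤-antisym y≤x x≤y)

  ≮⇒≥ : ∀ {x y} → ¬ x < y → y ≤ x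
  ≮⇒≥ {x} {y} x≮y with ≤-total x y | x ≟ y
  ... | inj₂ y≤x | _        = y≤x
  ... | inj₁ _   | yes refl = ≤-refl
  ... | inj₁ x≤y | no x≢y   = ⊥-elim (x≮y (x≤y , x≢y))

  fromℕ-nonNeg : ∀ n → 0# ≤ fromℕ n
  fromℕ-nonNeg zero    = ≤-refl
  fromℕ-nonNeg (suc n) = subst (_≤ fromℕ (suc n)) (+-identityˡ 0#)
    (⊕-mono-≤ 0≤1 (fromℕ-nonNeg n))

  1≤fromℕ-suc : ∀ n → 1# ≤ fromℕ (suc n)
  1≤fromℕ-suc n = subst (_≤ fromℕ (suc n)) (+-identityʳ 1#)
    (⊕-monoʳ-≤ 1# (fromℕ-nonNeg n))

  fromℕ-suc≢0 : ∀ n → fromℕ (suc n) ≢ 0#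
  fromℕ-suc≢0 n eq = 1≰0 (subst (1# ≤_) eq (1≤fromℕ-suc n))

  fromℕ-+ : ∀ m n → fromℕ (m + n) ≡ fromℕ m ⊕ fromℕ n
  fromℕ-+ zero    n = sym (+-identityˡ (fromℕ n))
  fromℕ-+ (suc m) n = trans (cong (1# ⊕_) (fromℕ-+ m n)) (sym (+-assoc 1# (fromℕ m) (fromℕ n)))

  -- The order axioms do not mention the inverse: were it nonpositive, its negation times
  -- `fromℕ (suc n)` would be a nonnegative number equal to `- 1#`.
  ⁻¹-nonNeg : ∀ n → 0# ≤ fromℕ (suc n) ⁻¹
  ⁻¹-nonNeg n with ≤-total 0# (fromℕ (suc n) ⁻¹)
  ... | inj₁ 0≤i = 0≤i
  ... | inj₂ i≤0 = ⊥-elim (1≰0 (0≤-⇒≤0 (subst (0# ≤_) eq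
                     (*-nonNeg (fromℕ-nonNeg (suc n)) (≤0⇒0≤- i≤0)))))
    where
    s = fromℕ (suc n)
    eq : s * - (s ⁻¹) ≡ - 1#
    eq = trans (sym (-‿distribʳ-* s (s ⁻¹))) (cong -_ (*-inverseʳ s (fromℕ-suc≢0 n)))

  tenths-+ : ∀ m n → tenths (m + n) ≡ tenths m ⊕ tenths n
  tenths-+ m n = trans (cong (_* fromℕ 10 ⁻¹) (fromℕ-+ m n))
    (distribʳ (fromℕ 10 ⁻¹) (fromℕ m) (fromℕ n))

  tenths-0 : tenths 0 ≡ 0#
  tenths-0 = zeroˡ (fromℕ 10 ⁻¹)

  tenths-10 : tenths 10 ≡ 1#
  tenths-10 = *-inverseʳ (fromℕ 10) (fromℕ-suc≢0 9)

  tenths-fromℕ : ∀ n → tenths (n ℕ.* 10) ≡ fromℕ n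
  tenths-fromℕ zero    = tenths-0
  tenths-fromℕ (suc n) = trans (tenths-+ 10 (n ℕ.* 10))
    (cong₂ _⊕_ tenths-10 (tenths-fromℕ n))

  tenths-nonNeg : ∀ n → 0# ≤ tenths n
  tenths-nonNeg n = *-nonNeg (fromℕ-nonNeg n) (⁻¹-nonNeg 9)

  tenths-mono : ∀ {m n} → m ℕ.≤ n → tenths m ≤ tenths n
  tenths-mono {m} {n} m≤n = begin
    tenths m                   ≡⟨ +-identityʳ (tenths m) ⟨
    tenths m ⊕ 0#              ≤⟨ ⊕-monoʳ-≤ (tenths m) (tenths-nonNeg (n ℕ.∸ m)) ⟩
    tenths m ⊕ tenths (n ℕ.∸ m) ≡⟨ tenths-+ m (n ℕ.∸ m) ⟨
    tenths (m + (n ℕ.∸ m))     ≡⟨ cong tenths (ℕ.m+[n∸m]≡n m≤n) ⟩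
    tenths n                   ∎
    where open ≤-Reasoning poset

  tenths-cancelˡ : ∀ m n → tenths (m + n) ⊕ - tenths m ≡ tenths n
  tenths-cancelˡ m n = trans
    (cong (_⊕ - tenths m) (trans (tenths-+ m n) (+-comm (tenths m) (tenths n))))
    (x⊕y⊕-y (tenths n) (tenths m))

  -- The bounds are natural numbers of tenths, so that comparing them is a computation in `ℕ`.
  record Within (a b : ℕ) (x : ℝ) : Set where
    constructor within
    field
      lower : tenths a ≤ x
      upper : x ≤ tenths b

  open Within public

  Within-⊆ : ∀ {a a′ b b′ x} → a′ ℕ.≤ a → b ℕ.≤ b′ → Within a b x → Within a′ b′ x
  Within-⊆ a′≤a b≤b′ (within a≤x x≤b) =
    within (≤-trans (tenths-mono a′≤a) a≤x) (≤-trans x≤b (tenths-mono b≤b′))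

  ≤tenths-add : ∀ {m n x y} → x ≤ tenths m → y ≤ tenths n → x ⊕ y ≤ tenths (m + n)
  ≤tenths-add {m} {n} x≤m y≤n = subst (_ ≤_) (sym (tenths-+ m n)) (⊕-mono-≤ x≤m y≤n)

  ≤tenths-sub : ∀ {m n x y} → x ≤ tenths (m + n) → y ≤ - tenths m → x ⊕ y ≤ tenths n
  ≤tenths-sub {m} {n} x≤ y≤ = subst (_ ≤_) (tenths-cancelˡ m n) (⊕-mono-≤ x≤ y≤)

  tenths≤-add : ∀ {m n x y} → tenths m ≤ x → tenths n ≤ y → tenths (m + n) ≤ x ⊕ y
  tenths≤-add {m} {n} m≤x n≤y = subst (_≤ _) (sym (tenths-+ m n)) (⊕-mono-≤ m≤x n≤y)

  tenths≤-sub : ∀ {m n x y} → tenths (m + n) ≤ x → - tenths m ≤ y → tenths n ≤ x ⊕ y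
  tenths≤-sub {m} {n} ≤x ≤y = subst (_≤ _) (tenths-cancelˡ m n) (⊕-mono-≤ ≤x ≤y)

  Noise : Pred ℝ 0ℓ
  Noise γ = - tenths 4 ≤ γ × γ ≤ tenths 4

  Within-heat : ∀ {a b x γ} → Within a b x → Noise γ →
                Within (6 + a) (b + 14) (x ⊕ 1# ⊕ γ)
  Within-heat {a} {b} {x} {γ} (within a≤x x≤b) (-4≤γ , γ≤4) = within
    (tenths≤-sub {4} {6 + a}
      (subst (λ k → tenths k ≤ x ⊕ 1#) (ℕ.+-comm a 10)
        (tenths≤-add {a} {10} a≤x (≤-reflexive tenths-10)))
      -4≤γ)
    (subst (λ k → x ⊕ 1# ⊕ γ ≤ tenths k) (ℕ.+-assoc b 10 4)
      (≤tenths-add {b + 10} {4}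
        (≤tenths-add {b} {10} x≤b (≤-reflexive (sym tenths-10))) γ≤4))

  -- The drop lies between 0.8 - 0.4 and 1 + 0.4, which covers both variants at once.
  Within-cool : ∀ {a b h x γ} → tenths 8 ≤ h → h ≤ 1# →
                Within (14 + a) (4 + b) x → Noise γ → Within a b (x ⊕ - h ⊕ γ)
  Within-cool {a} {b} {h} {x} {γ} 8≤h h≤1 (within ≤x x≤) (-4≤γ , γ≤4) = within
    (tenths≤-sub {4} {a}
      (tenths≤-sub {10} {4 + a} ≤x
        (-‿anti-≤ (subst (h ≤_) (sym tenths-10) h≤1)))
      -4≤γ)
    -- The noise is added before the heat loss is subtracted: `4 + b` may be less than 8, whereas
    -- `4 + b + 4` is `8 + b`.
    (subst (_≤ tenths b) (sym (x⊕-y⊕z x h γ))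
      (≤tenths-sub {8} {b}
        (subst (λ k → x ⊕ γ ≤ tenths k) (ℕ.+-comm (4 + b) 4)
          (≤tenths-add {4 + b} {4} x≤ γ≤4))
        (-‿anti-≤ 8≤h)))

module _ (𝓡 : Reals) (𝓝 : Names) where
  open Reals 𝓡
  open RealArithmetic 𝓡
  open Names 𝓝
  open Calculus 𝓡 𝓝

  -- Decidability of time-guardedness.

  _guardedIn?_ : ∀ {m n} (X : Fin n) (P : Proc m n) → Dec (X GuardedIn P)
  X guardedIn? nil           = yes tt
  X guardedIn? tick P        = yes tt
  X guardedIn? (P ∥ Q)       = (X guardedIn? P) ×-dec (X guardedIn? Q)
  X guardedIn? (⌊ π ∙ P ⌋ Q) = X guardedIn? P
  X guardedIn? ite g P Q     = (X guardedIn? P) ×-dec (X guardedIn? Q)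
  X guardedIn? (P ∖ c)       = X guardedIn? P
  X guardedIn? pvar Y        = ¬? (X Fin.≟ Y)
  X guardedIn? fix P         = suc X guardedIn? P

  -- On the concrete processes below the decision computes to `yes`, from which the proof of
  -- guardedness is extracted.
  timeGuarded? : ∀ {m n} (P : Proc m n) → Dec (TimeGuarded P)
  timeGuarded? nil           = yes tt
  timeGuarded? (tick P)      = timeGuarded? P
  timeGuarded? (P ∥ Q)       = timeGuarded? P ×-dec timeGuarded? Q
  timeGuarded? (⌊ π ∙ P ⌋ Q) = timeGuarded? P ×-dec timeGuarded? Q
  timeGuarded? (ite g P Q)   = timeGuarded? P ×-dec timeGuarded? Q
  timeGuarded? (P ∖ c)       = timeGuarded? P
  timeGuarded? (pvar X)      = yes tt
  timeGuarded? (fix P)       = (zero guardedIn? P) ×-dec timeGuarded? P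

  -- Control states of the engine and their temperature bounds.

  module EngineBisimulation
    (temp : 𝒳) (cool : 𝒜) (sₜ : 𝒮) (warning : 𝒞) (ID : Value)
    (on off : ℝ) (on<0 : on < 0#) (0≤off : 0# ≤ off) where
    open Engine temp cool sₜ warning ID on off

    -- The part of the cooling loop after its five ticks, once `Ctrl` has replaced the outer
    -- recursion variable. The closed `Ctrl` is weakened past the value and process binders around
    -- it. Substitution computes on these terms, so unfolding the controller gives exactly them.
    Recheck-open : Proc 0 1
    Recheck-open = read sₜ ⨾
      ite x>10 (send warning (val ID) ⨾ pvar zero)
               (write cool (val (real off)) ⨾ tick (renProc suc (substVal (weaken 1) Ctrl)))

    Loop Recheck : Process
    Loop    = fix (tick^ 5 Recheck-open)
    Recheck = Recheck-open [ Loop /X]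

    -- The guard is constant because the sensed value has already been substituted into it.
    Polled Rechecked : Value → Process
    Polled v    = ite (λ _ → exceeds10 v) (write cool (val (real on)) ⨾ Loop) (tick Ctrl)
    Rechecked v = ite (λ _ → exceeds10 v) (send warning (val ID) ⨾ Loop)
                      (write cool (val (real off)) ⨾ tick Ctrl)

    -- The index n bounds the number of τ-steps that remain before the next tick.
    -- Temperatures are bounded in tenths of a degree.  With k ticks of cooling to
    -- go, each lowering the temperature by between 0.4 and 1.4 degrees whichever
    -- the variant, it still has to end up between 2.9 and 9.5.

    data Reachable : (n : ℕ) (t a : ℝ) → Process → Set where
      polling   : ∀ {t a} → 0# ≤ a → Within 0 115 t → Reachable 2 t a Ctrl
      hot       : ∀ {t a v} → exceeds10 v ≡ true → Within 99 115 t →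
                  Reachable 1 t a (Polled v)
      cold      : ∀ {n t a v} → exceeds10 v ≡ false → 0# ≤ a → Within 0 101 t →
                  Reachable n t a (Polled v)
      looping   : ∀ {n t a} → a < 0# → Within 99 115 t → Reachable n t a Loop
      cooling   : ∀ {t a} k → k ℕ.≤ 4 → a < 0# →
                  Within (k ℕ.* 14 + 29) (k ℕ.* 4 + 95) t →
                  Reachable 2 t a (tick^ k Recheck)
      rechecked : ∀ {t a v} → exceeds10 v ≡ false → Within 29 95 t →
                  Reachable 1 t a (Rechecked v)
      resuming  : ∀ {n t a} → 0# ≤ a → Within 0 101 t → Reachable n t a (tick Ctrl)

    -- The interval is the invariant of the environment, expressed in tenths.
    safe : ∀ {n t a P} → Reachable n t a P → Within 0 300 t
    safe (polling _ w)       = Within-⊆ z≤n (ℕ.m≤m+n 115 _) w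
    safe (hot _ w)           = Within-⊆ z≤n (ℕ.m≤m+n 115 _) w
    safe (cold _ _ w)        = Within-⊆ z≤n (ℕ.m≤m+n 101 _) w
    safe (looping _ w)       = Within-⊆ z≤n (ℕ.m≤m+n 115 _) w
    safe (cooling k k≤4 _ w) = Within-⊆ z≤n
      -- The upper bound is largest at `k = 4`, where it is 16 + 95 = 111.
      (ℕ.≤-trans (ℕ.+-monoˡ-≤ 95 (ℕ.*-monoˡ-≤ 4 k≤4)) (ℕ.m≤m+n 111 _)) w
    safe (rechecked _ w)     = Within-⊆ z≤n (ℕ.m≤m+n 95 _) w
    safe (resuming _ w)      = Within-⊆ z≤n (ℕ.m≤m+n 101 _) w

    -- Well-formedness of the reachable processes.

    IsWellFormed : Process → Set
    IsWellFormed P = TimeGuarded P × ProcOver ｛ cool ｝ ｛ sₜ ｝ P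

    Loop-over : ProcOver ｛ cool ｝ ｛ sₜ ｝ Loop
    Loop-over = refl , ((tt , tt , tt) , refl , Ctrl-over , tt) , tt

    tick^-wellFormed : ∀ k {P} → IsWellFormed P → IsWellFormed (tick^ k P)
    tick^-wellFormed zero    wf = wf
    tick^-wellFormed (suc k) wf = tick^-wellFormed k wf

    wellFormed : ∀ {n t a P} → Reachable n t a P → IsWellFormed P
    wellFormed (polling _ _)     = Ctrl-timeGuarded , Ctrl-over
    wellFormed {P = P} (hot _ _) =
      toWitness {a? = timeGuarded? P} tt , (refl , Loop-over , tt) , Ctrl-over
    wellFormed {P = P} (cold _ _ _) =
      toWitness {a? = timeGuarded? P} tt , (refl , Loop-over , tt) , Ctrl-over
    wellFormed {P = P} (looping _ _) = toWitness {a? = timeGuarded? P} tt , Loop-over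
    wellFormed (cooling k _ _ _) = tick^-wellFormed k
      (toWitness {a? = timeGuarded? Recheck} tt ,
       (refl , ((tt , Loop-over , tt) , refl , Ctrl-over , tt) , tt))
    wellFormed {P = P} (rechecked _ _) =
      toWitness {a? = timeGuarded? P} tt , (tt , Loop-over , tt) , refl , Ctrl-over , tt
    wellFormed (resuming _ _) = Ctrl-timeGuarded , Ctrl-over

    -- What each control state can do.

    record Reads (P : Process) (K : Value → Process) : Set where
      constructor mkReads
      field
        enabled : ∀ {v} → P –[ rd sₜ v ]→ K v
        only    : ∀ {l Q} → P –[ l ]→ Q → ∃[ v ] (l ≡ rd sₜ v × Q ≡ K v)

    record Writes (P : Process) (r : ℝ) (Q : Process) : Set where
      constructor mkWrites
      field
        enabled : P –[ wr cool (real r) ]→ Q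
        only    : ∀ {l R} → P –[ l ]→ R → l ≡ wr cool (real r) × R ≡ Q

    record Ticks (P Q : Process) : Set where
      constructor mkTicks
      field
        enabled : P –tick→ Q
        silent  : ∀ {l R} → ¬ (P –[ l ]→ R)
        only    : ∀ {R} → P –tick→ R → R ≡ Q

    Measured : ℝ → Pred ℝ 0ℓ
    Measured t r = t ⊕ - tenths 1 ≤ r × r ≤ t ⊕ tenths 1

    -- This is heat h ξu for a the value of the actuator cool in ξu.

    heating : ℝ → ℝ → ℝ
    heating h a = if does (a <? 0#) then - h else 1#

    -- A read or a write spends one unit of the index, and a tick grants a fresh bound `m`; at index
    -- 0 only a tick is left.
    data Behaviour (h t a : ℝ) (P : Process) : ℕ → Set where
      reads  : ∀ {n K} → Reads P K →
               (∀ {r} → Measured t r → Reachable n t a (K (real r))) →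
               Behaviour h t a P (suc n)
      writes : ∀ {n r Q} → Writes P r Q → Reachable n t r Q →
               Behaviour h t a P (suc n)
      ticks  : ∀ {n m Q} → Ticks P Q →
               (∀ {γ} → Noise γ → Reachable m (t ⊕ heating h a ⊕ γ) a Q) →
               Behaviour h t a P n

    -- Effect of measurements and ticks on the bounds.

    module _ {t r : ℝ} (m : Measured t r) where

      -- The sensor error of 0.1 turns the threshold 10 into 9.9 for a hot reading and, in the next
      -- lemma, into 10.1 for a cold one.
      measured-hot : fromℕ 10 < r → tenths 99 ≤ t
      measured-hot (10≤r , _) = subst (tenths 99 ≤_) (x⊕y⊕-y t (tenths 1))
        (tenths≤-sub {1} {99}
          (≤-trans (≤-reflexive (tenths-fromℕ 10)) (≤-trans 10≤r (proj₂ m))) ≤-refl)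

      measured-cold : ¬ fromℕ 10 < r → t ≤ tenths 101
      measured-cold 10≮r = subst (_≤ tenths 101) (x⊕-y⊕y t (tenths 1))
        (≤tenths-add {100} {1}
          (≤-trans (proj₁ m) (≤-trans (≮⇒≥ 10≮r) (≤-reflexive (sym (tenths-fromℕ 10)))))
          ≤-refl)

      -- This excludes the warning: the reading is at most 9.5 + 0.1, which is below the threshold.
      rechecked-cold : t ≤ tenths 95 → exceeds10 (real r) ≡ false
      rechecked-cold t≤95 = dec-false (fromℕ 10 <? r) (≤⇒≯ (begin
        r              ≤⟨ proj₂ m ⟩
        t ⊕ tenths 1   ≤⟨ ≤tenths-add {95} {1} t≤95 ≤-refl ⟩
        tenths 96      ≤⟨ tenths-mono (ℕ.m≤m+n 96 4) ⟩
        tenths 100     ≡⟨ tenths-fromℕ 10 ⟩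
        fromℕ 10       ∎))
        where open ≤-Reasoning poset

    -- With the cooling off a tick adds between 0.6 and 1.4, and 10.1 + 1.4 = 11.5; the lower bound
    -- is relaxed to the 0 that `polling` asks for.
    heat-step : ∀ {h t a γ} → 0# ≤ a → Within 0 101 t → Noise γ →
                Within 0 115 (t ⊕ heating h a ⊕ γ)
    heat-step {h} {t} {a} {γ} 0≤a w n =
      subst (λ b → Within 0 115 (t ⊕ (if b then - h else 1#) ⊕ γ))
        (sym (dec-false (a <? 0#) (≤⇒≯ 0≤a)))
        (Within-⊆ z≤n ℕ.≤-refl (Within-heat {0} {101} w n))

    cool-step : ∀ {l u h t a γ} → tenths 8 ≤ h → h ≤ 1# → a < 0# →
                Within (14 + l) (4 + u) t → Noise γ →
                Within l u (t ⊕ heating h a ⊕ γ)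
    cool-step {l} {u} {h} {t} {a} {γ} 8≤h h≤1 a<0 w n =
      subst (λ b → Within l u (t ⊕ (if b then - h else 1#) ⊕ γ))
        (sym (dec-true (a <? 0#) a<0))
        (Within-cool {l} {u} 8≤h h≤1 w n)

    -- The value of the guard is known only through an equation, so the chosen branch is reached by
    -- transport along it.
    ite⁻ : ∀ {g : Guard 0} {b P Q l R} → g [] ≡ b →
           ite g P Q –[ l ]→ R → (if b then P else Q) –[ l ]→ R
    ite⁻ {P = P} {Q} {l} {R} eq (iteᵖ s) =
      subst (λ b → (if b then P else Q) –[ l ]→ R) eq s

    ite⁺ : ∀ {g : Guard 0} {b P Q l R} → g [] ≡ b →
           (if b then P else Q) –[ l ]→ R → ite g P Q –[ l ]→ R
    ite⁺ {P = P} {Q} {l} {R} eq s =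
      iteᵖ (subst (λ b → (if b then P else Q) –[ l ]→ R) (sym eq) s)

    ite-tick⁻ : ∀ {g : Guard 0} {b P Q R} → g [] ≡ b →
                ite g P Q –tick→ R → (if b then P else Q) –tick→ R
    ite-tick⁻ {P = P} {Q} {R} eq (iteᵗ s) =
      subst (λ b → (if b then P else Q) –tick→ R) eq s

    ite-tick⁺ : ∀ {g : Guard 0} {b P Q R} → g [] ≡ b →
                (if b then P else Q) –tick→ R → ite g P Q –tick→ R
    ite-tick⁺ {P = P} {Q} {R} eq s =
      iteᵗ (subst (λ b → (if b then P else Q) –tick→ R) (sym eq) s)

    ite-writes : ∀ {g : Guard 0} {b P Q r R} → g [] ≡ b →
                 Writes (if b then P else Q) r R → Writes (ite g P Q) r R
    ite-writes eq (mkWrites enabled only) =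
      mkWrites (ite⁺ eq enabled) (λ s → only (ite⁻ eq s))

    ite-ticks : ∀ {g : Guard 0} {b P Q R} → g [] ≡ b →
                Ticks (if b then P else Q) R → Ticks (ite g P Q) R
    ite-ticks eq (mkTicks enabled silent only) =
      mkTicks (ite-tick⁺ eq enabled) (λ s → silent (ite⁻ eq s)) (λ s → only (ite-tick⁻ eq s))

    tick-ticks : ∀ {P} → Ticks (tick P) P
    tick-ticks = mkTicks tickᵗ (λ ()) (λ { tickᵗ → refl })

    -- One clause per control state: the bounds decide the branch, and the successor state satisfies
    -- its own bounds again.
    behaviour : ∀ {h n t a P} → tenths 8 ≤ h → h ≤ 1# → Reachable n t a P →
                Behaviour h t a P n
    behaviour {t = t} {a} _ _ (polling 0≤a w) =
      -- Two unfoldings: the recursion of `Ctrl`, then the `fix` by which `⨾` is encoded.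
      reads (mkReads (fixᵖ (fixᵖ readᵖ)) λ { (fixᵖ (fixᵖ readᵖ)) → _ , refl , refl }) after
      where
      after : ∀ {r} → Measured t r → Reachable 1 t a (Polled (real r))
      after {r} m with fromℕ 10 <? r
      ... | yes 10<r =
        hot {v = real r} (dec-true (fromℕ 10 <? r) 10<r)
            (within (measured-hot m 10<r) (upper w))
      ... | no  10≮r =
        cold {v = real r} (dec-false (fromℕ 10 <? r) 10≮r) 0≤a
             (within (lower w) (measured-cold m 10≮r))
    behaviour _ _ (hot eq w) =
      writes (ite-writes eq (mkWrites (fixᵖ writeᵖ) λ { (fixᵖ writeᵖ) → refl , refl }))
             (looping on<0 w)
    behaviour _ _ (cold eq 0≤a w) =
      ticks (ite-ticks eq tick-ticks) (λ n → polling 0≤a (heat-step 0≤a w n))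
    behaviour 8≤h h≤1 (looping a<0 w) =
      ticks (mkTicks (fixᵗ tickᵗ) (λ { (fixᵖ ()) }) (λ { (fixᵗ tickᵗ) → refl }))
            -- The first of five ticks turns the bounds 99 and 115 into 99 - 14 = 4 * 14 + 29 and
            -- 115 - 4 = 4 * 4 + 95.
            (λ n → cooling 4 ℕ.≤-refl a<0 (cool-step 8≤h h≤1 a<0 w n))
    behaviour _ _ (cooling zero _ a<0 w) =
      reads (mkReads (fixᵖ readᵖ) λ { (fixᵖ readᵖ) → _ , refl , refl })
            (λ {r} m → rechecked {v = real r} (rechecked-cold m (upper w)) w)
    behaviour 8≤h h≤1 (cooling (suc k) k<4 a<0 w) =
      ticks tick-ticks (λ n → cooling k (ℕ.<⇒≤ k<4) a<0 (cool-step 8≤h h≤1 a<0 w n))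
    behaviour _ _ (rechecked eq w) =
      -- The false guard selects the branch that switches the cooling off.
      writes (ite-writes eq (mkWrites (fixᵖ writeᵖ) λ { (fixᵖ writeᵖ) → refl , refl }))
             (resuming {0} 0≤off (Within-⊆ z≤n (ℕ.m≤m+n 95 6) w))
    behaviour _ _ (resuming 0≤a w) =
      ticks tick-ticks (λ n → polling 0≤a (heat-step 0≤a w n))

    -- From processes to systems.

    Env : ℝ → ℝ^ ｛ temp ｝ → ℝ^ ｛ cool ｝ → PhysEnv
    Env h x u = record (Envʰ h) { ξx = x ; ξu = u }

    -- Letting `h` range from 0.8 to 1 puts the states of both variants into one predicate.
    data Good : System → Set₁ where
      good : ∀ {h n x u P} → tenths 8 ≤ h → h ≤ 1# →
             Reachable n (x tempᵉ) (u coolᵉ) P → Good (Env h x u ⋈ P)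

    data Internal : Label → Set where
      τ    : Internal τ
      tick : Internal tick

    -- Zero sensor error, like zero noise in the next lemma, is always admissible; hence an enabled
    -- read or tick can actually be performed.
    measured-exact : ∀ t → Measured t t
    measured-exact t =
      subst (t ⊕ - tenths 1 ≤_) (x⊕0 t) (⊕-monoʳ-≤ t (0≤⇒-≤0 (tenths-nonNeg 1))) ,
      subst (_≤ t ⊕ tenths 1) (x⊕0 t) (⊕-monoʳ-≤ t (tenths-nonNeg 1))

    noise-0 : Noise 0#
    noise-0 = 0≤⇒-≤0 (tenths-nonNeg 4) , tenths-nonNeg 4

    module _ (h : ℝ) (x : ℝ^ ｛ temp ｝) (u : ℝ^ ｛ cool ｝) where

      private
        t = x tempᵉ
        a = u coolᵉ

      invariant : Within 0 300 t → Inv (Env h x u) ≡ true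
      invariant (within 0≤t t≤300) = cong₂ _∧_
        (dec-true (0# ≤? t) (≤-trans (≤-reflexive (sym tenths-0)) 0≤t))
        (dec-true (t ≤? fromℕ 30) (≤-trans t≤300 (≤-reflexive (tenths-fromℕ 30))))

      -- The decision `cool ≟ᴬ cool` is abstract and does not reduce, so the written value is
      -- recovered only up to an equation.
      updateAct-cool : ∀ r → PhysEnv.ξu (updateAct (Env h x u) coolᵉ r) coolᵉ ≡ r
      updateAct-cool r =
        cong (λ b → if b then r else a) (dec-true (cool ≟ᴬ cool) refl)

      read-step : ∀ {P K} → Inv (Env h x u) ≡ true → Reads P K →
                  Env h x u ⋈ P –τ→ Env h x u ⋈ K (real t)
      read-step i R = sensRead sₜᵉ i (Reads.enabled R) ((λ _ → t) , measured-exact t , refl)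

      write-step : ∀ {P r Q} → Inv (Env h x u) ≡ true → Writes P r Q →
                   Env h x u ⋈ P –τ→ updateAct (Env h x u) coolᵉ r ⋈ Q
      write-step i W = actWrite coolᵉ i (Writes.enabled W)

      tick-silent : ∀ {P Q} → Ticks P Q → ¬ (∃[ M ] Env h x u ⋈ P –τ→ M)
      tick-silent T (_ , sensRead _ _ s _) = Ticks.silent T s
      tick-silent T (_ , actWrite _ _ s)   = Ticks.silent T s
      tick-silent T (_ , tau _ s)          = Ticks.silent T s

      tick-step : ∀ {P Q} → Inv (Env h x u) ≡ true → Ticks P Q →
                  Env h x u ⋈ P ⟶[ tick ] Env h (λ _ → t ⊕ heating h a ⊕ 0#) u ⋈ Q
      tick-step i T = time i (Ticks.enabled T) (tick-silent T)
        (_ , (0# , proj₁ noise-0 , proj₂ noise-0 , refl) , refl)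

      module _ (8≤h : tenths 8 ≤ h) (h≤1 : h ≤ 1#) where

        written : ∀ {n r Q} → Reachable n t r Q → Good (updateAct (Env h x u) coolᵉ r ⋈ Q)
        written {n} {r} {Q} ρ = good 8≤h h≤1
          (subst (λ a → Reachable n t a Q) (sym (updateAct-cool r)) ρ)

        Behaviour-step : ∀ {n P α M} → Behaviour h t a P n → Env h x u ⋈ P ⟶[ α ] M →
                         Internal α × Good M
        Behaviour-step (reads R _) (out _ s) with Reads.only R s
        ... | _ , () , _
        Behaviour-step (reads R _) (inp _ s) with Reads.only R s
        ... | _ , () , _
        -- Membership proofs are irrelevant: once the name is identified with `sₜ`, the sensor is
        -- `sₜᵉ`.
        Behaviour-step (reads R ρ) (τ (sensRead (_ , [ _ ]) _ s (_ , m , refl)))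
          with Reads.only R s
        ... | _ , refl , refl = τ , good 8≤h h≤1 (ρ m)
        Behaviour-step (reads R _) (τ (actWrite _ _ s)) with Reads.only R s
        ... | _ , () , _
        Behaviour-step (reads R _) (τ (tau _ s)) with Reads.only R s
        ... | _ , () , _
        -- The process may time out, but the enabled read gives a τ-step of the system, and this
        -- blocks time.
        Behaviour-step (reads R _) (time i _ ¬τ _) = ⊥-elim (¬τ (_ , read-step i R))
        Behaviour-step (writes W _) (out _ s) with Writes.only W s
        ... | () , _
        Behaviour-step (writes W _) (inp _ s) with Writes.only W s
        ... | () , _
        Behaviour-step (writes W _) (τ (sensRead _ _ s _)) with Writes.only W s
        ... | () , _
        Behaviour-step (writes W ρ) (τ (actWrite (_ , [ _ ]) _ s)) with Writes.only W s
        ... | refl , refl = τ , written ρ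
        Behaviour-step (writes W _) (τ (tau _ s)) with Writes.only W s
        ... | () , _
        Behaviour-step (writes W _) (time i _ ¬τ _) = ⊥-elim (¬τ (_ , write-step i W))
        Behaviour-step (ticks T _) (out _ s) = ⊥-elim (Ticks.silent T s)
        Behaviour-step (ticks T _) (inp _ s) = ⊥-elim (Ticks.silent T s)
        Behaviour-step (ticks T _) (τ s)     = ⊥-elim (tick-silent T (_ , s))
        Behaviour-step (ticks {m = m} {Q} T ρ) (time _ s _ (_ , (_ , -4≤γ , γ≤4 , eq) , refl))
          with Ticks.only T s
        ... | refl = tick , good 8≤h h≤1
          (subst (λ t → Reachable m t a Q) (sym eq) (ρ (-4≤γ , γ≤4)))

    Good-step : ∀ {M M′ α} → Good M → M ⟶[ α ] M′ → Internal α × Good M′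
    Good-step (good {h} {x = x} {u} 8≤h h≤1 ρ) =
      Behaviour-step h x u 8≤h h≤1 (behaviour 8≤h h≤1 ρ)

    Good-wellFormed : ∀ {M} → Good M → WellFormed M
    Good-wellFormed (good _ _ ρ) = wellFormed ρ

    -- Reaching the next tick.

    Progress : System → Set₁
    Progress M = ∃[ M′ ] (M ⇒[ tick ] M′ × Good M′)

    infixr 5 _◅ᴾ_

    _◅ᴾ_ : ∀ {M N} → M –τ→ N → Progress N → Progress M
    s ◅ᴾ (M′ , (_ , _ , ss , t , us) , g) = M′ , (_ , _ , s ◅ ss , t , us) , g

    -- Recursion on the bound `n` on the τ-steps: reads return the exact temperature, and the final
    -- tick takes zero noise.
    progress : ∀ n h x u {P} → tenths 8 ≤ h → h ≤ 1# →
               Reachable n (x tempᵉ) (u coolᵉ) P → Progress (Env h x u ⋈ P)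
    progress n h x u 8≤h h≤1 ρ with behaviour 8≤h h≤1 ρ
    ... | reads {n′} R after =
      read-step h x u i R ◅ᴾ
      progress n′ h x u 8≤h h≤1 (after (measured-exact (x tempᵉ)))
      where i = invariant h x u (safe ρ)
    ... | writes {n′} {Q = Q} W after =
      write-step h x u i W ◅ᴾ
      progress n′ h x _ 8≤h h≤1
        (subst (λ a → Reachable n′ (x tempᵉ) a Q) (sym (updateAct-cool h x u _)) after)
      where i = invariant h x u (safe ρ)
    ... | ticks T after =
      _ , (_ , _ , ε , tick-step h x u i T , ε) , good 8≤h h≤1 (after noise-0)
      where i = invariant h x u (safe ρ)

    Good-progress : ∀ {M} → Good M → Progress M
    Good-progress (good {h} {n} {x} {u} 8≤h h≤1 ρ) = progress n h x u 8≤h h≤1 ρ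

    -- The bisimulation.

    BothGood : Rel CPS (lsuc 0ℓ)
    BothGood M N = Good (value M) × Good (value N)

    BothGood-isBisimulation : IsBisimulation BothGood
    BothGood-isBisimulation = record
      { symmetric = λ (g , g′) → g′ , g
      ; transfer  = λ {M} {N} {M′} → transfer {M} {N} {M′}
      }
      where
      transfer : ∀ {M N M′ α} → BothGood M N → value M ⟶[ α ] value M′ →
                 ∃[ N′ ] (value N ⇒̂[ α ] value N′ × BothGood M′ N′)
      transfer {N = N} (g , g′) s with Good-step g s
      ... | τ    , g″ = N , ε , g″ , g′
      -- The temperatures reached on the two sides may differ, since `BothGood` constrains each
      -- system separately.
      ... | tick , g″ with Good-progress g′
      ...   | N′ , w , g‴ = (N′ , [ Good-wellFormed g‴ ]) , w , g″ , g‴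

    engine-good : ∀ {h} → tenths 8 ≤ h → h ≤ 1# → Good (value (engine h))
    engine-good 8≤h h≤1 = good 8≤h h≤1
      (polling 0≤off (within (≤-reflexive tenths-0) (tenths-nonNeg 115)))

    Eng≈Engᵛ : Eng ≈ Engᵛ
    Eng≈Engᵛ = BothGood , BothGood-isBisimulation ,
      -- The rates 1 and 0.8 are the endpoints of the range in `Good`.
      engine-good 8≤1 ≤-refl , engine-good ≤-refl 8≤1
      where
      8≤1 : tenths 8 ≤ 1#
      8≤1 = ≤-trans (tenths-mono (ℕ.m≤m+n 8 2)) (≤-reflexive tenths-10)

proposition12 : (𝓡 : Reals) (𝓝 : Names) →
    let open Reals 𝓡
        open Names 𝓝
        open Calculus 𝓡 𝓝 in
    (temp : 𝒳) (cool : 𝒜) (sₜ : 𝒮) (warning : 𝒞) (ID : Value)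
    (on off : ℝ) → on < 0# → 0# ≤ off →
    let open Engine temp cool sₜ warning ID on off in
    Eng ≈ Engᵛ
proposition12 𝓡 𝓝 temp cool sₜ warning ID on off on<0 0≤off =
  EngineBisimulation.Eng≈Engᵛ 𝓡 𝓝 temp cool sₜ warning ID on off on<0 0≤off
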